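{- Let $s\ge0$ be an integer with $s\ne1$, let $h\in\mathbb C\setminus\{0\}$, and let $q\in\mathbb C\setminus\{0\}$ be either $1$ or not a root of unity. Let $n\ge1$ and let $\mathbf r=(r_1,\ldots,r_n)$, $\mathbf s=(s_1,\ldots,s_n)$ be sequences of nonnegative integers. Then, as formal power series in $x$, $$B^{\mathbf r,\mathbf s}_{s,h,q}[x]=\left(\sum_{j=0}^\infty h^{|\mathbf s|-j}(-1)^jq^{\binom j2(1-s)}\frac{x^j}{[j]_{q,1-s}!}\right)\left(\sum_{j=0}^\infty\Omega^{\mathbf r,\mathbf s}_{s,q}[j]\frac{x^j}{h^j[j]_{q,1-s}!}\right),$$ where $$\Omega^{\mathbf r,\mathbf s}_{s,q}[j]=\prod_{t=1}^n\bigl[\,j-(s_1+\cdots+s_{t-1})+(r_1+\cdots+r_{t-1})/(1-s)\,\bigr]^{(\underline{s_t})}_{q,1-s}.$$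
   Context: For an integer $x$, $[x]_q=\frac{q^x-1}{q-1}$ if $q\ne1$ and $[x]_1=x$. For $r\in\mathbb R$ and an integer $j\ge0$, $[r]^{(\underline j)}_{q,1-s}=[r(1-s)]_q[(r-1)(1-s)]_q\cdots[(r-j+1)(1-s)]_q$ (in the statement all the numbers $(r-i)(1-s)$ that occur are integers), and $[n]_{q,1-s}!=[n]^{(\underline n)}_{q,1-s}$. $|\cdot|$ denotes the sum of the entries of a finite sequence. The numbers $S^{\mathbf r,\mathbf s}_{s,h,q}[k]$ are the normal ordering coefficients of $H_{\mathbf r,\mathbf s}=V^{r_n}U^{s_n}\cdots V^{r_2}U^{s_2}V^{r_1}U^{s_1}$ where $UV-qVU=hV^s$: in the algebra $\mathbb C\langle U,V\rangle/(UV-qVU-hV^s)$ (in which the monomials $V^iU^j$, $i,j\ge0$, form a basis), $H_{\mathbf r,\mathbf s}=\sum_{k=s_1}^{|\mathbf s|}S^{\mathbf r,\mathbf s}_{s,h,q}[k]\,V^{|\mathbf r|-(|\mathbf s|-k)(1-s)}U^k$, the coefficient being taken as $0$ when the exponent of $V$ is negative. The generalized $q$-Bell polynomial is $B^{\mathbf r,\mathbf s}_{s,h,q}[x]=\sum_{k=s_1}^{|\mathbf s|}S^{\mathbf r,\mathbf s}_{s,h,q}[k]x^k$. -}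

module Defs where

open import Algebra.Apartness.Bundles using (HeytingField; HeytingCommutativeRing)
open import Algebra.Bundles using (CommutativeRing; Ring; Semiring; RawSemiring)
import Algebra.Apartness.Properties.HeytingCommutativeRing as HeytingProperties
import Algebra.Definitions.RawSemiring as RawSemiringDefinitions
import Algebra.Properties.CommutativeSemigroup as CommutativeSemigroupProperties
import Algebra.Properties.Ring as RingProperties
open import Data.Bool.Base using (if_then_else_)
open import Data.Fin.Base using (Fin; toℕ) renaming (zero to fzero; suc to fsuc)
open import Data.Fin.Properties using (toℕ<n)
open import Data.Integer.Base as ℤ using (ℤ; +_; -[1+_]; 0ℤ; 1ℤ)
import Data.Integer.Properties as ℤP
import Data.List.Base as List
open import Data.Nat.Base as ℕ using (ℕ; zero; suc; NonZero; _∸_)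
open import Data.Nat.Combinatorics using (_C_)
import Data.Nat.Properties as ℕP
open import Data.Product.Base using (_,_; proj₁)
open import Data.Rational.Base as ℚ using (ℚ; ↥_)
open import Data.Rational.Literals using (fromℤ)
import Data.Rational.Properties as ℚP
open import Data.Sum.Base using (_⊎_; inj₁; inj₂; [_,_]′)
open import Data.Vec.Base as Vec using (Vec; []; _∷_; head; lookup)
open import Data.Vec.Functional using (Vector)
open import Function.Base using (_∘_)
open import Level using (_⊔_)
open import Relation.Binary.PropositionalEquality as ≡ using (_≡_; _≢_; cong; cong₂)
import Relation.Binary.Reasoning.Setoid as SetoidReasoning
open import Relation.Nullary.Decidable.Core using (does)
open import Relation.Nullary.Negation.Core using (contradiction)

-- The integers a, a + 1, …, b; empty when b < a.
range : (a b : ℕ) → Vector ℕ (suc b ∸ a)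
range a b i = a ℕ.+ toℕ i

prefixSum : ∀ {n} → Vec ℕ n → Fin n → ℕ
prefixSum v t = List.sum (List.take (toℕ t) (Vec.toList v))

1-_ : ℕ → ℤ
1- s = 1ℤ ℤ.- (+ s)

1-s≢0 : ∀ {s} → s ≢ 1 → 1- s ≢ 0ℤ
1-s≢0 {s} s≢1 eq = s≢1 (≡.sym (ℤP.+-injective (ℤP.i-j≡0⇒i≡j 1ℤ (+ s) eq)))

1-s-nonZero : ∀ {s} → s ≢ 1 → ℤ.NonZero (1- s)
1-s-nonZero s≢1 = ℤ.≢-nonZero (1-s≢0 s≢1)

fromℤ-+ : ∀ x y → fromℤ x ℚ.+ fromℤ y ≡ fromℤ (x ℤ.+ y)
fromℤ-+ x y = ≡.trans
  (cong (ℚ._/ 1) (cong₂ ℤ._+_ (ℤP.*-identityʳ x) (ℤP.*-identityʳ y)))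
  (ℚP.↥p/↧p≡p (fromℤ (x ℤ.+ y)))

fromℤ-* : ∀ x y → fromℤ x ℚ.* fromℤ y ≡ fromℤ (x ℤ.* y)
fromℤ-* x y = ℚP.↥p/↧p≡p (fromℤ (x ℤ.* y))

fromℤ-neg : ∀ x → ℚ.- fromℤ x ≡ fromℤ (ℤ.- x)
fromℤ-neg (+ zero)   = ≡.refl
fromℤ-neg (+ suc _)  = ≡.refl
fromℤ-neg (-[1+ _ ]) = ≡.refl

fromℤ-[x-y]*z : ∀ x y z → (fromℤ x ℚ.- fromℤ y) ℚ.* fromℤ z ≡ fromℤ ((x ℤ.- y) ℤ.* z)
fromℤ-[x-y]*z x y z = ≡.trans
  (cong (ℚ._* fromℤ z)
    (≡.trans (cong (fromℤ x ℚ.+_) (fromℤ-neg y)) (fromℤ-+ x (ℤ.- y))))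
  (fromℤ-* (x ℤ.- y) z)

-- K generalises ℂ: of ℂ only the field structure and characteristic zero are
-- used. Apartness _#_ is classically ≠.
module FieldNotions {c ℓ₁ ℓ₂} (K : HeytingField c ℓ₁ ℓ₂) where

  open HeytingField K
  open HeytingProperties heytingCommutativeRing
  open CommutativeRing (HeytingCommutativeRing.commutativeRing heytingCommutativeRing)
    using (ring; semiring; *-commutativeSemigroup)
  open RawSemiringDefinitions (Semiring.rawSemiring semiring) using (_×_; _^_; product)
  open RingProperties ring using (-‿distribˡ-*)
  open CommutativeSemigroupProperties *-commutativeSemigroup using (interchange)
  open SetoidReasoning setoid

  CharacteristicZero : Set ℓ₂
  CharacteristicZero = ∀ m → .{{NonZero m}} → m × 1# # 0#

  NotRootOfUnity : Carrier → Set ℓ₂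
  NotRootOfUnity q = ∀ m → .{{NonZero m}} → q ^ m # 1#

  -- The library states invertibility for x - 0# rather than for x.
  inverse : ∀ {x} → x # 0# → Carrier
  inverse x#0 = proj₁ (#⇒invertible x#0)

  inverseˡ : ∀ {x} (x#0 : x # 0#) → inverse x#0 * x ≈ 1#
  inverseˡ {x} x#0 with #⇒invertible x#0
  ... | x⁻¹ , eq , _ = trans (*-congˡ (sym (x-0≈x x))) eq

  divide : ∀ x y → y # 0# → Carrier
  divide x y y#0 = x * inverse y#0

  power : ∀ x → x # 0# → ℤ → Carrier
  power x x#0 (+ m)    = x ^ m
  power x x#0 -[1+ m ] = inverse x#0 ^ suc m

  embed : ℤ → Carrier
  embed (+ m)    = m × 1#
  embed -[1+ m ] = - (suc m × 1#)

  x#y⇒x-y#0 : ∀ {x y} → x # y → x - y # 0#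
  x#y⇒x-y#0 {x} {y} x#y with #⇒invertible x#y
  ... | z , eq , _ = invertibleˡ⇒# (z , trans (*-congˡ (x-0≈x (x - y))) eq)

  x-y#0⇒x#y : ∀ {x y} → x - y # 0# → x # y
  x-y#0⇒x#y x-y#0 = invertibleˡ⇒# (inverse x-y#0 , inverseˡ x-y#0)

  *-#-monoʳ : ∀ {x y z} → x # y → z # 0# → x * z # y * z
  *-#-monoʳ {x} {y} {z} x#y z#0 = x-y#0⇒x#y
    (#-congʳ (trans (distribʳ z x (- y)) (+-congˡ (sym (-‿distribˡ-* y z))))
      (x#0y#0→xy#0 (x#y⇒x-y#0 x#y) z#0))

  -x#0 : ∀ {x} → x # 0# → - x # 0#
  -x#0 {x} x#0 =
    #-congʳ (+-identityˡ (- x)) (x#y⇒x-y#0 (#-sym x#0))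

  inverse#0 : ∀ {x} (x#0 : x # 0#) → inverse x#0 # 0#
  inverse#0 {x} x#0 = invertibleʳ⇒#
    (x , trans (*-congʳ (x-0≈x (inverse x#0))) (inverseˡ x#0))

  ^-#0 : ∀ {x} → x # 0# → ∀ m → x ^ m # 0#
  ^-#0 x#0 zero    = 1#0
  ^-#0 x#0 (suc m) = x#0y#0→xy#0 x#0 (^-#0 x#0 m)

  ^-inverseˡ : ∀ {x} (x#0 : x # 0#) m → (inverse x#0 ^ m) * (x ^ m) ≈ 1#
  ^-inverseˡ x#0 zero = *-identityˡ 1#
  ^-inverseˡ {x} x#0 (suc m) = begin
    (inverse x#0 * (inverse x#0 ^ m)) * (x * (x ^ m)) ≈⟨ interchange _ _ _ _ ⟩
    (inverse x#0 * x) * ((inverse x#0 ^ m) * (x ^ m)) ≈⟨ *-cong (inverseˡ x#0) (^-inverseˡ x#0 m) ⟩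
    1# * 1#                                           ≈⟨ *-identityˡ 1# ⟩
    1#                                                ∎

  product#0 : ∀ {n} (f : Vector Carrier n) → (∀ i → f i # 0#) → product f # 0#
  product#0 {zero}  f f#0 = 1#0
  product#0 {suc n} f f#0 = x#0y#0→xy#0 (f#0 fzero) (product#0 (f ∘ fsuc) (f#0 ∘ fsuc))

  embed#0 : CharacteristicZero → ∀ {x} → x ≢ 0ℤ → embed x # 0#
  embed#0 char0 {+ zero}   x≢0 = contradiction ≡.refl x≢0
  embed#0 char0 {+ suc m}  _   = char0 (suc m)
  embed#0 char0 { -[1+ m ]} _  = -x#0 (char0 (suc m))

  power#1 : ∀ {q} (q#0 : q # 0#) → NotRootOfUnity q → ∀ {x} → x ≢ 0ℤ → power q q#0 x # 1#
  power#1 q#0 q^m#1 {+ zero}  x≢0 = contradiction ≡.refl x≢0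
  power#1 q#0 q^m#1 {+ suc m} _   = q^m#1 (suc m)
  power#1 {q} q#0 q^m#1 { -[1+ m ]} _ = #-sym
    (#-congʳ (trans (*-comm _ _) (^-inverseˡ q#0 (suc m)))
      (#-congˡ (*-identityˡ _)
        (*-#-monoʳ (q^m#1 (suc m)) (^-#0 (inverse#0 q#0) (suc m)))))

  q#1 : ∀ {q} → NotRootOfUnity q → q # 1#
  q#1 {q} q^m#1 = #-congʳ (*-identityʳ q) (q^m#1 1)

  qNumberOf : ∀ q → q # 0# → q ≈ 1# ⊎ NotRootOfUnity q → ℤ → Carrier
  qNumberOf q q#0 (inj₁ _)     x = embed x
  qNumberOf q q#0 (inj₂ q^m#1) x =
    divide (power q q#0 x - 1#) (q - 1#) (x#y⇒x-y#0 (q#1 q^m#1))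

  qNumberOf#0 : ∀ q (q#0 : q # 0#) (q-generic : q ≈ 1# ⊎ NotRootOfUnity q) →
    CharacteristicZero → ∀ {x} → x ≢ 0ℤ → qNumberOf q q#0 q-generic x # 0#
  qNumberOf#0 q q#0 (inj₁ _)     char0 x≢0 = embed#0 char0 x≢0
  qNumberOf#0 q q#0 (inj₂ q^m#1) char0 x≢0 =
    x#0y#0→xy#0 (x#y⇒x-y#0 (power#1 q#0 q^m#1 x≢0)) (inverse#0 (x#y⇒x-y#0 (q#1 q^m#1)))

module NormalOrdering
  {c ℓ₁ ℓ₂} (K : HeytingField c ℓ₁ ℓ₂)
  (char0 : FieldNotions.CharacteristicZero K)
  (s : ℕ) (s≢1 : s ≢ 1)
  (h : HeytingField.Carrier K) (h#0 : HeytingField._#_ K h (HeytingField.0# K))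
  (q : HeytingField.Carrier K) (q#0 : HeytingField._#_ K q (HeytingField.0# K))
  (q-generic : HeytingField._≈_ K q (HeytingField.1# K) ⊎ FieldNotions.NotRootOfUnity K q)
  where

  open HeytingField K
  open HeytingProperties heytingCommutativeRing
  open CommutativeRing (HeytingCommutativeRing.commutativeRing heytingCommutativeRing)
    using (semiring)
  open RawSemiringDefinitions (Semiring.rawSemiring semiring) using (_^_; sum; product)
  open FieldNotions K

  qNumber : ℤ → Carrier
  qNumber = qNumberOf q q#0 q-generic

  -- [ρ]^(j)_{q,1-s}.  It is only used where every (ρ - i)(1 - s) with i < j is
  -- an integer; ↥_ (the reduced numerator) then returns that integer.
  fallingFactorial : ℚ → ℕ → Carrier
  fallingFactorial ρ j =
    product λ (i : Fin j) → qNumber (↥ ((ρ ℚ.- fromℤ (+ toℕ i)) ℚ.* fromℤ (1- s)))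

  qFactorial : ℕ → Carrier
  qFactorial n = fallingFactorial (fromℤ (+ n)) n

  qFactorial#0 : ∀ n → qFactorial n # 0#
  qFactorial#0 n = product#0 _ λ i → ≡.subst (λ ρ → qNumber (↥ ρ) # 0#)
    (≡.sym (fromℤ-[x-y]*z (+ n) (+ toℕ i) (1- s)))
    (qNumberOf#0 q q#0 q-generic char0 λ eq → [ n-i≢0 i , 1-s≢0 s≢1 ]′
                        (ℤP.i*j≡0⇒i≡0∨j≡0 ((+ n) ℤ.- (+ toℕ i)) eq))
    where
    n-i≢0 : (i : Fin n) → (+ n) ℤ.- (+ toℕ i) ≢ 0ℤ
    n-i≢0 i eq = ℕP.<⇒≢ (toℕ<n i) (≡.sym (ℤP.+-injective (ℤP.i-j≡0⇒i≡j (+ n) (+ toℕ i) eq)))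

  -- The algebra K⟨U,V⟩/(UV - qVU - hVˢ): noncommutative polynomial
  -- expressions modulo the least congruence that makes them a unital
  -- K-algebra in which the commutation relation holds.

  infixl 6 _⊕_
  infixl 7 _⊗_
  infix  8 ⊖_

  data Expr : Set c where
    U V         : Expr
    scalar      : Carrier → Expr
    _⊕_ _⊗_     : Expr → Expr → Expr
    ⊖_          : Expr → Expr

  exprRawSemiring : RawSemiring c c
  exprRawSemiring = record
    { _≈_ = _≡_ ; _+_ = _⊕_ ; _*_ = _⊗_ ; 0# = scalar 0# ; 1# = scalar 1# }

  module Alg = RawSemiringDefinitions exprRawSemiring

  infix 4 _∼_

  data _∼_ : Expr → Expr → Set (c ⊔ ℓ₁) where
    ∼-refl        : ∀ {a} → a ∼ a
    ∼-sym         : ∀ {a b} → a ∼ b → b ∼ a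
    ∼-trans       : ∀ {a b d} → a ∼ b → b ∼ d → a ∼ d
    ⊕-cong        : ∀ {a a′ b b′} → a ∼ a′ → b ∼ b′ → a ⊕ b ∼ a′ ⊕ b′
    ⊗-cong        : ∀ {a a′ b b′} → a ∼ a′ → b ∼ b′ → a ⊗ b ∼ a′ ⊗ b′
    ⊖-cong        : ∀ {a a′} → a ∼ a′ → ⊖ a ∼ ⊖ a′
    ⊕-assoc       : ∀ a b d → (a ⊕ b) ⊕ d ∼ a ⊕ (b ⊕ d)
    ⊕-comm        : ∀ a b → a ⊕ b ∼ b ⊕ a
    ⊕-identityˡ   : ∀ a → scalar 0# ⊕ a ∼ a
    ⊖-inverseˡ    : ∀ a → ⊖ a ⊕ a ∼ scalar 0#
    ⊗-assoc       : ∀ a b d → (a ⊗ b) ⊗ d ∼ a ⊗ (b ⊗ d)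
    ⊗-identityˡ   : ∀ a → scalar 1# ⊗ a ∼ a
    ⊗-identityʳ   : ∀ a → a ⊗ scalar 1# ∼ a
    ⊗-distribˡ-⊕  : ∀ a b d → a ⊗ (b ⊕ d) ∼ a ⊗ b ⊕ a ⊗ d
    ⊗-distribʳ-⊕  : ∀ a b d → (b ⊕ d) ⊗ a ∼ b ⊗ a ⊕ d ⊗ a
    scalar-cong   : ∀ {x y} → x ≈ y → scalar x ∼ scalar y
    scalar-+      : ∀ x y → scalar (x + y) ∼ scalar x ⊕ scalar y
    scalar-*      : ∀ x y → scalar (x * y) ∼ scalar x ⊗ scalar y
    scalar-comm   : ∀ x a → scalar x ⊗ a ∼ a ⊗ scalar x
    commutation   : U ⊗ V ∼ scalar q ⊗ (V ⊗ U) ⊕ scalar h ⊗ (V Alg.^ s)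

  algebra : Ring c (c ⊔ ℓ₁)
  algebra = record
    { Carrier = Expr ; _≈_ = _∼_ ; _+_ = _⊕_ ; _*_ = _⊗_ ; -_ = ⊖_
    ; 0# = scalar 0# ; 1# = scalar 1#
    ; isRing = record
      { +-isAbelianGroup = record
        { isGroup = record
          { isMonoid = record
            { isSemigroup = record
              { isMagma = record
                { isEquivalence = record { refl = ∼-refl ; sym = ∼-sym ; trans = ∼-trans }
                ; ∙-cong = ⊕-cong }
              ; assoc = ⊕-assoc }
            ; identity = ⊕-identityˡ , λ a → ∼-trans (⊕-comm a (scalar 0#)) (⊕-identityˡ a) }
          ; inverse = ⊖-inverseˡ , λ a → ∼-trans (⊕-comm a (⊖ a)) (⊖-inverseˡ a)
          ; ⁻¹-cong = ⊖-cong }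
        ; comm = ⊕-comm }
      ; *-cong = ⊗-cong
      ; *-assoc = ⊗-assoc
      ; *-identity = ⊗-identityˡ , ⊗-identityʳ
      ; distrib = ⊗-distribˡ-⊕ , ⊗-distribʳ-⊕
      }
    }

  -- V^{rₙ} U^{sₙ} ⋯ V^{r₁} U^{s₁}: the first entries are the rightmost factors.
  H : ∀ {n} → Vec ℕ n → Vec ℕ n → Expr
  H []       []       = scalar 1#
  H (r ∷ 𝐫) (t ∷ 𝐬) = H 𝐫 𝐬 ⊗ ((V Alg.^ r) ⊗ (U Alg.^ t))

  exponentV : ∀ {n} → Vec ℕ n → Vec ℕ n → ℕ → ℤ
  exponentV 𝐫 𝐬 k = (+ Vec.sum 𝐫) ℤ.- ((+ Vec.sum 𝐬) ℤ.- (+ k)) ℤ.* (1- s)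

  -- a V^e U^k, read as 0 when e is negative.
  monomialVU : Carrier → ℤ → ℕ → Expr
  monomialVU a (+ e)    k = scalar a ⊗ ((V Alg.^ e) ⊗ (U Alg.^ k))
  monomialVU a -[1+ _ ] k = scalar 0#

  -- S is the family of normal ordering coefficients S[k], s₁ ≤ k ≤ |𝐬|; its
  -- values at other k play no role.
  record IsNormalOrdering {n} (𝐫 𝐬 : Vec ℕ (suc n)) (S : ℕ → Carrier) : Set (c ⊔ ℓ₁) where
    field
      expansion : H 𝐫 𝐬 ∼ Alg.sum
        (λ i → let k = range (head 𝐬) (Vec.sum 𝐬) i in monomialVU (S k) (exponentV 𝐫 𝐬 k) k)
      vanishing : ∀ k → head 𝐬 ℕ.≤ k → k ℕ.≤ Vec.sum 𝐬 →
        exponentV 𝐫 𝐬 k ℤ.< 0ℤ → S k ≈ 0#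

  -- The value at m is the coefficient of xᵐ.
  PowerSeries : Set c
  PowerSeries = ℕ → Carrier

  infix  4 _≋_
  infixl 7 _⋆_

  _≋_ : PowerSeries → PowerSeries → Set ℓ₁
  f ≋ g = ∀ m → f m ≈ g m

  _⋆_ : PowerSeries → PowerSeries → PowerSeries
  (f ⋆ g) m = sum λ (i : Fin (suc m)) → f (toℕ i) * g (m ∸ toℕ i)

  monomial : Carrier → ℕ → PowerSeries
  monomial a k m = if does (k ℕP.≟ m) then a else 0#

  bellPolynomial : ∀ {n} → Vec ℕ (suc n) → (ℕ → Carrier) → PowerSeries
  bellPolynomial 𝐬 S m =
    sum λ i → let k = range (head 𝐬) (Vec.sum 𝐬) i in monomial (S k) k m

  Ω : ∀ {n} → Vec ℕ n → Vec ℕ n → ℕ → Carrier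
  Ω {n} 𝐫 𝐬 j = product λ (t : Fin n) → fallingFactorial
    (fromℤ (+ j) ℚ.- fromℤ (+ prefixSum 𝐬 t)
      ℚ.+ ℚ._÷_ (fromℤ (+ prefixSum 𝐫 t)) (fromℤ (1- s)) {{1-s-nonZero s≢1}})
    (lookup 𝐬 t)

  exponentialFactor : ∀ {n} → Vec ℕ n → PowerSeries
  exponentialFactor 𝐬 j = divide
    (power h h#0 ((+ Vec.sum 𝐬) ℤ.- (+ j)) * (- 1#) ^ j * power q q#0 ((+ (j C 2)) ℤ.* (1- s)))
    (qFactorial j) (qFactorial#0 j)

  ΩSeries : ∀ {n} → Vec ℕ n → Vec ℕ n → PowerSeries
  ΩSeries 𝐫 𝐬 j = divide (Ω 𝐫 𝐬 j) (h ^ j * qFactorial j)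
    (x#0y#0→xy#0 (^-#0 h#0 j) (qFactorial#0 j))

-- Let the algebra act on the module with basis (eₐ), a ∈ ℤ, by V eₐ = eₐ₊₁ and
-- U eₐ = h [a]_q eₐ₋₍₁₋ₛ₎.  Every monomial sends eₐ to a multiple of one basis
-- vector.  Comparing these multiples on both sides of the normal ordering
-- expansion at a = j(1-s) gives
--   h^|𝐬| Ω[j] = Σₖ S[k] hᵏ [j]^(k).
-- Dividing by hʲ [j]!, this says that h^|𝐬| times the Ω-series is Bell(x) E(x),
-- where E(x) = Σⱼ xʲ / (hʲ [j]!).  The other factor is h^|𝐬| / E(x) by the
-- q-Leibniz rule for xʲ ↦ h [j(1-s)]_q xʲ.

module Submission where

open import Defs
open import Algebra.Apartness.Bundles using (HeytingField; HeytingCommutativeRing)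
open import Algebra.Bundles using (CommutativeMonoid; CommutativeRing)
import Algebra.Apartness.Properties.HeytingCommutativeRing as HeytingProperties
import Algebra.Properties.CommutativeMonoid.Sum as CommutativeMonoidSum
import Algebra.Properties.CommutativeSemigroup as CommutativeSemigroupProperties
import Algebra.Properties.Monoid.Mult as MonoidMult
import Algebra.Properties.Ring as RingProperties
import Algebra.Properties.Semiring.Exp as SemiringExp
import Algebra.Properties.Semiring.Sum as SemiringSum
import Algebra.Solver.Ring.NaturalCoefficients.Default as SemiringSolver
open import Data.Bool.Base using (true; false)
open import Data.Fin.Base using (Fin; toℕ) renaming (suc to fsuc)
open import Data.Fin.Properties using (toℕ<n)
open import Data.Integer.Base as ℤ using (ℤ; +_; -[1+_]; 0ℤ; 1ℤ; _⊖_)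
import Data.Integer.Properties as ℤP
open import Data.Integer.Tactic.RingSolver using (solve-∀)
open import Data.Nat.Base as ℕ using (ℕ; zero; suc; _∸_)
open import Data.Nat.Combinatorics using (_C_; nC1≡n; nCk+nC[k+1]≡[n+1]C[k+1])
import Data.Nat.Properties as ℕP
open import Data.Rational.Base as ℚ using (ℚ; ↥_)
open import Data.Rational.Literals using (fromℤ)
import Data.Rational.Properties as ℚP
open import Data.Sum.Base using (_⊎_; inj₁; inj₂; [_,_]′)
open import Data.Vec.Base as Vec using (Vec; []; _∷_; head; lookup)
open import Relation.Binary.PropositionalEquality as ≡ using (_≡_; _≢_; cong; cong₂)
import Relation.Binary.Reasoning.Setoid as SetoidReasoning
open import Relation.Nullary.Decidable.Core using (does)

-- Integer multiples in a commutative monoid.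

module IntegerMultiples {c ℓ} (M : CommutativeMonoid c ℓ) where

  open CommutativeMonoid M
  open MonoidMult monoid using (_×_; ×-homo-+)
  open CommutativeSemigroupProperties commutativeSemigroup using (interchange)
  open SetoidReasoning setoid

  -- Read additively this serves `embed`, read multiplicatively `power`. The values of `f` are
  -- prescribed only up to `≈`, because `embed -[1+ m ]` is the negative of a multiple rather than a
  -- multiple of the negative.
  module _ {a a′ : Carrier} (a′∙a≈ε : a′ ∙ a ≈ ε)
    (f : ℤ → Carrier)
    (f-+ : ∀ m → f (+ m) ≈ m × a) (f-neg : ∀ m → f -[1+ m ] ≈ suc m × a′) where

    -- One `a` and one `a′` cancel each time `suc m ⊖ suc n` is reduced to `m ⊖ n`.
    homo-⊖ : ∀ m n → f (m ⊖ n) ≈ m × a ∙ n × a′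
    homo-⊖ m zero = trans (f-+ m) (sym (identityʳ _))
    homo-⊖ zero (suc n) = trans (f-neg n) (sym (identityˡ _))
    homo-⊖ (suc m) (suc n) = begin
      f (suc m ⊖ suc n)              ≡⟨ cong f (ℤP.[1+m]⊖[1+n]≡m⊖n m n) ⟩
      f (m ⊖ n)                      ≈⟨ homo-⊖ m n ⟩
      m × a ∙ n × a′                 ≈⟨ identityˡ _ ⟨
      ε ∙ (m × a ∙ n × a′)           ≈⟨ ∙-congʳ (trans (comm a a′) a′∙a≈ε) ⟨
      (a ∙ a′) ∙ (m × a ∙ n × a′)    ≈⟨ interchange _ _ _ _ ⟩
      (a ∙ m × a) ∙ (a′ ∙ n × a′)    ∎

    homo-+ : ∀ x y → f (x ℤ.+ y) ≈ f x ∙ f y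
    homo-+ (+ m) (+ n) =
      trans (f-+ (m ℕ.+ n)) (trans (×-homo-+ a m n) (sym (∙-cong (f-+ m) (f-+ n))))
    homo-+ (+ m) -[1+ n ] = trans (homo-⊖ m (suc n)) (sym (∙-cong (f-+ m) (f-neg n)))
    homo-+ -[1+ m ] (+ n) =
      trans (homo-⊖ n (suc m)) (trans (comm _ _) (sym (∙-cong (f-neg m) (f-+ n))))
    homo-+ -[1+ m ] -[1+ n ] = begin
      f -[1+ suc (m ℕ.+ n) ]         ≈⟨ f-neg (suc (m ℕ.+ n)) ⟩
      suc (suc (m ℕ.+ n)) × a′       ≡⟨ cong (λ k → suc k × a′) (ℕP.+-suc m n) ⟨
      (suc m ℕ.+ suc n) × a′         ≈⟨ ×-homo-+ a′ (suc m) (suc n) ⟩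
      suc m × a′ ∙ suc n × a′        ≈⟨ ∙-cong (f-neg m) (f-neg n) ⟨
      f -[1+ m ] ∙ f -[1+ n ]        ∎

-- Integer powers and q-numbers in the field.

module FieldProperties {c ℓ₁ ℓ₂} (K : HeytingField c ℓ₁ ℓ₂) where

  open HeytingField K
  open HeytingProperties heytingCommutativeRing
  open CommutativeRing (HeytingCommutativeRing.commutativeRing heytingCommutativeRing)
    using (ring; semiring; commutativeSemiring; +-commutativeMonoid; *-commutativeMonoid)
  open SemiringExp semiring using (_^_)
  open MonoidMult (CommutativeMonoid.monoid +-commutativeMonoid) using (_×_)
  open RingProperties ring using (-‿+-comm; -0#≈0#)
  open FieldNotions K
  open SemiringSolver commutativeSemiring using (solve; _:+_; _:*_; _:=_)
  open SetoidReasoning setoid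

  *-cancelˡ-#0 : ∀ {x} y z → x # 0# → x * y ≈ x * z → y ≈ z
  *-cancelˡ-#0 {x} y z x#0 eq = begin
    y                       ≈⟨ rescale y ⟨
    inverse x#0 * (x * y)   ≈⟨ *-congˡ eq ⟩
    inverse x#0 * (x * z)   ≈⟨ rescale z ⟩
    z                       ∎
    where
    rescale : ∀ y → inverse x#0 * (x * y) ≈ y
    rescale y = trans (sym (*-assoc _ _ _)) (trans (*-congʳ (inverseˡ x#0)) (*-identityˡ y))

  divide-* : ∀ x {y} (y#0 : y # 0#) → divide x y y#0 * y ≈ x
  divide-* x y#0 = trans (*-assoc _ _ _) (trans (*-congˡ (inverseˡ y#0)) (*-identityʳ x))

  power-+ : ∀ {x} (x#0 : x # 0#) y z → power x x#0 (y ℤ.+ z) ≈ power x x#0 y * power x x#0 z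
  power-+ {x} x#0 = IntegerMultiples.homo-+ *-commutativeMonoid (inverseˡ x#0) (power x x#0)
    (λ _ → refl) (λ _ → refl)

  -‿×-comm : ∀ m x → - (m × x) ≈ m × (- x)
  -‿×-comm zero    x = -0#≈0#
  -‿×-comm (suc m) x = trans (sym (-‿+-comm x (m × x))) (+-congˡ (-‿×-comm m x))

  embed-+ : ∀ y z → embed (y ℤ.+ z) ≈ embed y + embed z
  embed-+ = IntegerMultiples.homo-+ +-commutativeMonoid (-‿inverseˡ 1#) embed
    (λ _ → refl) (λ m → -‿×-comm (suc m) 1#)

  power≈1 : ∀ {x} (x#0 : x # 0#) → x ≈ 1# → ∀ y → power x x#0 y ≈ 1#
  power≈1 {x} x#0 x≈1 = λ where
      (+ m)    → ^≈1 x≈1 m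
      -[1+ m ] → ^≈1 x⁻¹≈1 (suc m)
    where
    ^≈1 : ∀ {y} → y ≈ 1# → ∀ m → y ^ m ≈ 1#
    ^≈1 y≈1 zero    = refl
    ^≈1 y≈1 (suc m) = trans (*-cong y≈1 (^≈1 y≈1 m)) (*-identityˡ 1#)
    x⁻¹≈1 : inverse x#0 ≈ 1#
    x⁻¹≈1 = trans (sym (*-identityʳ _)) (trans (*-congˡ (sym x≈1)) (inverseˡ x#0))

  module _ {q} (q#0 : q # 0#) where

    qNumberOf-0 : ∀ q-generic → qNumberOf q q#0 q-generic 0ℤ ≈ 0#
    qNumberOf-0 (inj₁ _) = refl
    qNumberOf-0 (inj₂ _) = trans (*-congʳ (-‿inverseʳ 1#)) (zeroˡ _)

    qNumberOf-1 : ∀ q-generic → qNumberOf q q#0 q-generic 1ℤ ≈ 1#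
    qNumberOf-1 (inj₁ _)     = +-identityʳ 1#
    qNumberOf-1 (inj₂ q^m#1) =
      trans (*-congʳ (+-congʳ (*-identityʳ q))) (trans (*-comm _ _) (inverseˡ _))

    -- For `q ≈ 1#` the power is 1 and this is additivity of `embed`. Otherwise it is q^(x+y) - 1 =
    -- (q^x - 1) + q^x (q^y - 1), divided by q - 1.
    qNumberOf-+ : ∀ q-generic x y → let [_] = qNumberOf q q#0 q-generic in
      [ x ℤ.+ y ] ≈ [ x ] + power q q#0 x * [ y ]
    qNumberOf-+ (inj₁ q≈1) x y = trans (embed-+ x y)
      (+-congˡ (sym (trans (*-congʳ (power≈1 q#0 q≈1 x)) (*-identityˡ _))))
    qNumberOf-+ (inj₂ q^m#1) x y = begin
      (power q q#0 (x ℤ.+ y) - 1#) * i           ≈⟨ *-congʳ (+-congʳ (power-+ q#0 x y)) ⟩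
      (a * b - 1#) * i                           ≈⟨ +-identityʳ _ ⟨
      -- A semiring identity cannot cancel 1 against -1. Adding the zero term `a * i * (1# - 1#)`
      -- makes both sides agree with 1 and -1 treated as independent variables `u` and `v`.
      (a * b - 1#) * i + 0#                      ≈⟨ +-congˡ (zeroʳ (a * i)) ⟨
      (a * b - 1#) * i + a * i * 0#              ≈⟨ +-congˡ (*-congˡ (-‿inverseʳ 1#)) ⟨
      (a * b - 1#) * i + a * i * (1# - 1#)       ≈⟨ solve 5 (λ a b i u v →
           (a :* b :+ v) :* i :+ a :* i :* (u :+ v) :=
           (u :* a :+ v) :* i :+ a :* ((b :+ v) :* i)) refl a b i 1# (- 1#) ⟩
      (1# * a - 1#) * i + a * ((b - 1#) * i)     ≈⟨ +-congʳ (*-congʳ (+-congʳ (*-identityˡ a))) ⟩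
      (a - 1#) * i + a * ((b - 1#) * i)          ∎
      where
      a = power q q#0 x
      b = power q q#0 y
      i = inverse (x#y⇒x-y#0 (q#1 q^m#1))

-- Clearing the denominator 1 - s.

module ScaledRationals where

  open ≡.≡-Reasoning

  -- `ρ` may be a proper fraction as long as ρ d is an integer. Once the product is `fromℤ` of an
  -- integer, the `↥_` in `fallingFactorial` computes to that integer.
  [ρ-i]*d : ∀ ρ {a} d i → ρ ℚ.* fromℤ d ≡ fromℤ a →
    (ρ ℚ.- fromℤ i) ℚ.* fromℤ d ≡ fromℤ (a ℤ.- i ℤ.* d)
  [ρ-i]*d ρ {a} d i ρd≡a = begin
    (ρ ℚ.- fromℤ i) ℚ.* fromℤ d                   ≡⟨ ℚP.*-distribʳ-+ (fromℤ d) ρ (ℚ.- fromℤ i) ⟩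
    ρ ℚ.* fromℤ d ℚ.+ (ℚ.- fromℤ i) ℚ.* fromℤ d   ≡⟨ cong₂ ℚ._+_ ρd≡a (cong (ℚ._* fromℤ d) (fromℤ-neg i)) ⟩
    fromℤ a ℚ.+ fromℤ (ℤ.- i) ℚ.* fromℤ d         ≡⟨ cong (fromℤ a ℚ.+_) (fromℤ-* (ℤ.- i) d) ⟩
    fromℤ a ℚ.+ fromℤ (ℤ.- i ℤ.* d)               ≡⟨ fromℤ-+ a _ ⟩
    fromℤ (a ℤ.+ ℤ.- i ℤ.* d)                     ≡⟨ cong (λ x → fromℤ (a ℤ.+ x)) (ℤP.neg-distribˡ-* i d) ⟨
    fromℤ (a ℤ.- i ℤ.* d)                         ∎

  -- For d = 1 - s the first factor is the base of a falling factorial in `Ω`. Its only fractional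
  -- part is y/d, which the multiplication turns into y.
  [j-x+y/d]*d : ∀ j x y d .{{_ : ℤ.NonZero d}} →
    (fromℤ j ℚ.- fromℤ x ℚ.+ fromℤ y ℚ.÷ fromℤ d) ℚ.* fromℤ d
      ≡ fromℤ (j ℤ.* d ℤ.- x ℤ.* d ℤ.+ y)
  [j-x+y/d]*d j x y d = begin
    (fromℤ j ℚ.- fromℤ x ℚ.+ fromℤ y ℚ.÷ fromℤ d) ℚ.* fromℤ d
      ≡⟨ ℚP.*-distribʳ-+ (fromℤ d) (fromℤ j ℚ.- fromℤ x) (fromℤ y ℚ.÷ fromℤ d) ⟩
    (fromℤ j ℚ.- fromℤ x) ℚ.* fromℤ d ℚ.+ fromℤ y ℚ.÷ fromℤ d ℚ.* fromℤ d
      ≡⟨ cong₂ ℚ._+_ (fromℤ-[x-y]*z j x d) (ℚP.*-assoc (fromℤ y) (ℚ.1/ fromℤ d) (fromℤ d)) ⟩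
    fromℤ ((j ℤ.- x) ℤ.* d) ℚ.+ fromℤ y ℚ.* (ℚ.1/ fromℤ d ℚ.* fromℤ d)
      ≡⟨ cong (λ z → fromℤ ((j ℤ.- x) ℤ.* d) ℚ.+ fromℤ y ℚ.* z) (ℚP.*-inverseˡ (fromℤ d)) ⟩
    fromℤ ((j ℤ.- x) ℤ.* d) ℚ.+ fromℤ y ℚ.* ℚ.1ℚ
      ≡⟨ cong (fromℤ ((j ℤ.- x) ℤ.* d) ℚ.+_) (ℚP.*-identityʳ (fromℤ y)) ⟩
    fromℤ ((j ℤ.- x) ℤ.* d) ℚ.+ fromℤ y
      ≡⟨ fromℤ-+ ((j ℤ.- x) ℤ.* d) y ⟩
    fromℤ ((j ℤ.- x) ℤ.* d ℤ.+ y)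
      ≡⟨ cong fromℤ (distrib j x y d) ⟩
    fromℤ (j ℤ.* d ℤ.- x ℤ.* d ℤ.+ y) ∎
    where
    distrib : ∀ j x y d → (j ℤ.- x) ℤ.* d ℤ.+ y ≡ j ℤ.* d ℤ.- x ℤ.* d ℤ.+ y
    distrib = solve-∀

module NormalOrderingProperties
  {c ℓ₁ ℓ₂} (K : HeytingField c ℓ₁ ℓ₂)
  (char0 : FieldNotions.CharacteristicZero K)
  (s : ℕ) (s≢1 : s ≢ 1)
  (h : HeytingField.Carrier K) (h#0 : HeytingField._#_ K h (HeytingField.0# K))
  (q : HeytingField.Carrier K) (q#0 : HeytingField._#_ K q (HeytingField.0# K))
  (q-generic : HeytingField._≈_ K q (HeytingField.1# K) ⊎ FieldNotions.NotRootOfUnity K q)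
  where

  open HeytingField K
  open HeytingProperties heytingCommutativeRing
  open CommutativeRing (HeytingCommutativeRing.commutativeRing heytingCommutativeRing)
    using (ring; semiring; commutativeSemiring; +-commutativeMonoid; *-commutativeMonoid)
  open SemiringExp semiring using (_^_; ^-homo-*)
  open RingProperties ring using (-‿+-comm; -‿distribʳ-*; -1*x≈-x)
  open SemiringSum semiring using (*-distribˡ-sum; *-distribʳ-sum)
  open CommutativeMonoidSum +-commutativeMonoid
    using (sum; sum-cong-≋; sum-replicate-zero; ∑-distrib-+; ∑-comm)
  open CommutativeMonoidSum *-commutativeMonoid
    using () renaming (sum to product; sum-cong-≋ to product-cong)
  open FieldNotions K
  open FieldProperties K
  open NormalOrdering K char0 s s≢1 h h#0 q q#0 q-generic
  open SemiringSolver commutativeSemiring using (solve; _:+_; _:*_; _:=_; con)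
  open ScaledRationals
  open SetoidReasoning setoid

  -- q-numbers and falling factorials with step 1 - s.

  d : ℤ
  d = 1- s

  qPower : ℕ → Carrier
  qPower j = power q q#0 (+ j ℤ.* d)

  qNumber-0 : qNumber 0ℤ ≈ 0#
  qNumber-0 = qNumberOf-0 q#0 q-generic

  qNumber-+ : ∀ x y → qNumber (x ℤ.+ y) ≈ qNumber x + power q q#0 x * qNumber y
  qNumber-+ = qNumberOf-+ q#0 q-generic

  -- Splitting the 1 off on the left puts the factor q on `qNumber a`, the shape required by UV =
  -- qVU + hVˢ.
  qNumber-+1 : ∀ a → qNumber (a ℤ.+ 1ℤ) ≈ q * qNumber a + 1#
  qNumber-+1 a = begin
    qNumber (a ℤ.+ 1ℤ)                 ≡⟨ cong qNumber (ℤP.+-comm a 1ℤ) ⟩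
    qNumber (1ℤ ℤ.+ a)                 ≈⟨ qNumber-+ 1ℤ a ⟩
    qNumber 1ℤ + (q * 1#) * qNumber a  ≈⟨ +-cong (qNumberOf-1 q#0 q-generic) (*-congʳ (*-identityʳ q)) ⟩
    1# + q * qNumber a                 ≈⟨ +-comm _ _ ⟩
    q * qNumber a + 1#                 ∎

  qNumber-suc#0 : ∀ j → qNumber (+ suc j ℤ.* d) # 0#
  qNumber-suc#0 j = qNumberOf#0 q q#0 q-generic char0 λ eq →
    [ (λ ()) , 1-s≢0 s≢1 ]′ (ℤP.i*j≡0⇒i≡0∨j≡0 (+ suc j) eq)

  -- The falling factorial indexed by the integer a = ρ d instead of ρ, so that the argument
  -- descends in steps of `d` and no rational occurs.
  falling : ℤ → ℕ → Carrier
  falling a zero    = 1#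
  falling a (suc k) = qNumber a * falling (a ℤ.- d) k

  suc-*-d : ∀ k → + suc k ℤ.* d ≡ + k ℤ.* d ℤ.+ d
  suc-*-d k = ≡.trans (ℤP.suc-* (+ k) d) (ℤP.+-comm d _)

  suc-*-d∸d : ∀ k → + suc k ℤ.* d ℤ.- d ≡ + k ℤ.* d
  suc-*-d∸d k = ≡.trans (cong (ℤ._- d) (suc-*-d k)) (lemma (+ k ℤ.* d) d)
    where
    lemma : ∀ x y → x ℤ.+ y ℤ.- y ≡ x
    lemma = solve-∀

  falling-product : ∀ a k → (product λ (i : Fin k) → qNumber (a ℤ.- + toℕ i ℤ.* d)) ≈ falling a k
  falling-product a zero    = refl
  falling-product a (suc k) = *-cong
    (reflexive (cong qNumber (ℤP.+-identityʳ a)))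
    (trans (product-cong {k} λ i → reflexive (cong qNumber (shift (+ toℕ i ℤ.* d) (suc-*-d (toℕ i)))))
           (falling-product (a ℤ.- d) k))
    where
    rearrange : ∀ a x d → a ℤ.- (x ℤ.+ d) ≡ a ℤ.- d ℤ.- x
    rearrange = solve-∀
    shift : ∀ x {y} → y ≡ x ℤ.+ d → a ℤ.- y ≡ a ℤ.- d ℤ.- x
    shift x ≡.refl = rearrange a x d

  fallingFactorial-falling : ∀ ρ {a} k → ρ ℚ.* fromℤ d ≡ fromℤ a →
    fallingFactorial ρ k ≈ falling a k
  fallingFactorial-falling ρ {a} k ρd≡a = trans
    (product-cong {k} λ i → reflexive (cong (λ x → qNumber (↥ x)) ([ρ-i]*d ρ d (+ toℕ i) ρd≡a)))
    (falling-product a k)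

  qFactorial-suc : ∀ j → qFactorial (suc j) ≈ qNumber (+ suc j ℤ.* d) * qFactorial j
  qFactorial-suc j = begin
    qFactorial (suc j)                                       ≈⟨ fallingFactorial-falling (fromℤ (+ suc j)) (suc j) (fromℤ-* (+ suc j) d) ⟩
    qNumber (+ suc j ℤ.* d) * falling (+ suc j ℤ.* d ℤ.- d) j  ≡⟨ cong (λ x → qNumber (+ suc j ℤ.* d) * falling x j) (suc-*-d∸d j) ⟩
    qNumber (+ suc j ℤ.* d) * falling (+ j ℤ.* d) j          ≈⟨ *-congˡ (fallingFactorial-falling (fromℤ (+ j)) j (fromℤ-* (+ j) d)) ⟨
    qNumber (+ suc j ℤ.* d) * qFactorial j                   ∎

  -- The representation of the algebra.

  -- The right action of the algebra on the linear functionals φ of the module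
  -- with basis (eₐ), a ∈ ℤ, on which V eₐ = eₐ₊₁ and U eₐ = h [a] eₐ₋₍₁₋ₛ₎;
  -- φ a is the value of φ at eₐ.
  act : Expr → (ℤ → Carrier) → ℤ → Carrier
  act U          φ a = h * qNumber a * φ (a ℤ.- d)
  act V          φ a = φ (a ℤ.+ 1ℤ)
  act (scalar x) φ a = x * φ a
  act (X ⊕ Y)    φ a = act X φ a + act Y φ a
  act (X ⊗ Y)    φ a = act Y (act X φ) a
  act (⊖ X)      φ a = - act X φ a

  act-cong : ∀ X {φ ψ} → (∀ a → φ a ≈ ψ a) → ∀ a → act X φ a ≈ act X ψ a
  act-cong U          φ≈ψ a = *-congˡ (φ≈ψ _)
  act-cong V          φ≈ψ a = φ≈ψ _
  act-cong (scalar x) φ≈ψ a = *-congˡ (φ≈ψ a)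
  act-cong (X ⊕ Y)    φ≈ψ a = +-cong (act-cong X φ≈ψ a) (act-cong Y φ≈ψ a)
  act-cong (X ⊗ Y)    φ≈ψ a = act-cong Y (act-cong X φ≈ψ) a
  act-cong (⊖ X)      φ≈ψ a = -‿cong (act-cong X φ≈ψ a)

  act-+ : ∀ X φ ψ a → act X (λ b → φ b + ψ b) a ≈ act X φ a + act X ψ a
  act-+ U          φ ψ a = distribˡ _ _ _
  act-+ V          φ ψ a = refl
  act-+ (scalar x) φ ψ a = distribˡ _ _ _
  act-+ (X ⊕ Y)    φ ψ a = trans (+-cong (act-+ X φ ψ a) (act-+ Y φ ψ a))
    (solve 4 (λ x y z w → (x :+ y) :+ (z :+ w) := (x :+ z) :+ (y :+ w)) refl _ _ _ _)
  act-+ (X ⊗ Y)    φ ψ a = trans (act-cong Y (act-+ X φ ψ) a) (act-+ Y _ _ a)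
  act-+ (⊖ X)      φ ψ a = trans (-‿cong (act-+ X φ ψ a)) (sym (-‿+-comm _ _))

  act-* : ∀ X x φ a → act X (λ b → x * φ b) a ≈ x * act X φ a
  act-* U          x φ a = solve 3 (λ x y z → y :* (x :* z) := x :* (y :* z)) refl _ _ _
  act-* V          x φ a = refl
  act-* (scalar y) x φ a = solve 3 (λ x y z → y :* (x :* z) := x :* (y :* z)) refl _ _ _
  act-* (X ⊕ Y)    x φ a = trans (+-cong (act-* X x φ a) (act-* Y x φ a)) (sym (distribˡ _ _ _))
  act-* (X ⊗ Y)    x φ a = trans (act-cong Y (act-* X x φ) a) (act-* Y x _ a)
  act-* (⊖ X)      x φ a = trans (-‿cong (act-* X x φ a)) (-‿distribʳ-* _ _)

  act-V^ : ∀ r φ a → act (V Alg.^ r) φ a ≈ φ (a ℤ.+ + r)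
  act-V^ zero    φ a = trans (*-identityˡ _) (reflexive (cong φ (≡.sym (ℤP.+-identityʳ a))))
  act-V^ (suc r) φ a = trans (act-V^ r (act V φ) a) (reflexive (cong φ (lemma a (+ r))))
    where
    lemma : ∀ a r → a ℤ.+ r ℤ.+ 1ℤ ≡ a ℤ.+ (1ℤ ℤ.+ r)
    lemma = solve-∀

  -- Unfolding `X Alg.^ suc k` applies the extra `X` to the functional first. The recursion of
  -- `falling` starts at the index `a`, hence needs that `X` applied last.
  act-^-comm : ∀ X k φ a → act (X Alg.^ k) (act X φ) a ≈ act X (act (X Alg.^ k) φ) a
  act-^-comm X zero    φ a = sym (act-* X 1# φ a)
  act-^-comm X (suc k) φ a = act-^-comm X k (act X φ) a

  act-U^ : ∀ k φ a → act (U Alg.^ k) φ a ≈ h ^ k * falling a k * φ (a ℤ.- + k ℤ.* d)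
  act-U^ zero    φ a = *-cong (sym (*-identityˡ 1#)) (reflexive (cong φ (≡.sym (ℤP.+-identityʳ a))))
  act-U^ (suc k) φ a = begin
    act (U Alg.^ k) (act U φ) a                                                ≈⟨ act-^-comm U k φ a ⟩
    h * qNumber a * act (U Alg.^ k) φ (a ℤ.- d)                                ≈⟨ *-congˡ (act-U^ k φ (a ℤ.- d)) ⟩
    h * qNumber a * (h ^ k * falling (a ℤ.- d) k * φ (a ℤ.- d ℤ.- + k ℤ.* d))  ≈⟨ solve 5
      (λ x y z w v → x :* y :* (z :* w :* v) := x :* z :* (y :* w) :* v) refl _ _ _ _ _ ⟩
    h ^ suc k * falling a (suc k) * φ (a ℤ.- d ℤ.- + k ℤ.* d)                  ≡⟨ cong (λ b → h ^ suc k * falling a (suc k) * φ b)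
      (≡.trans (lemma a d (+ k ℤ.* d)) (cong (λ b → a ℤ.- b) (≡.sym (suc-*-d k)))) ⟩
    h ^ suc k * falling a (suc k) * φ (a ℤ.- + suc k ℤ.* d)                    ∎
    where
    lemma : ∀ a d x → a ℤ.- d ℤ.- x ≡ a ℤ.- (x ℤ.+ d)
    lemma = solve-∀

  -- All terms evaluate φ at the index a + 1 - d = a + s, and the coefficients agree by [a+1] = q
  -- [a] + 1.
  act-commutation : ∀ φ a → act (U ⊗ V) φ a ≈ act (scalar q ⊗ (V ⊗ U) ⊕ scalar h ⊗ (V Alg.^ s)) φ a
  act-commutation φ a = begin
    h * qNumber (a ℤ.+ 1ℤ) * φ (a ℤ.+ 1ℤ ℤ.- d)        ≈⟨ *-congʳ (*-congˡ (qNumber-+1 a)) ⟩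
    h * (q * qNumber a + 1#) * φ (a ℤ.+ 1ℤ ℤ.- d)      ≈⟨ solve 4
      (λ h q n f → h :* (q :* n :+ con 1) :* f := h :* n :* (q :* f) :+ h :* f) refl _ _ _ _ ⟩
    h * qNumber a * (q * φ (a ℤ.+ 1ℤ ℤ.- d)) + h * φ (a ℤ.+ 1ℤ ℤ.- d)
      ≡⟨ cong₂ (λ b e → h * qNumber a * (q * φ b) + h * φ e) (lemma₁ a d) (lemma₂ a (+ s)) ⟩
    h * qNumber a * (q * φ (a ℤ.- d ℤ.+ 1ℤ)) + h * φ (a ℤ.+ + s)
      ≈⟨ +-congˡ (act-V^ s (λ b → h * φ b) a) ⟨
    h * qNumber a * (q * φ (a ℤ.- d ℤ.+ 1ℤ)) + act (V Alg.^ s) (λ b → h * φ b) a  ∎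
    where
    lemma₁ : ∀ a d → a ℤ.+ 1ℤ ℤ.- d ≡ a ℤ.- d ℤ.+ 1ℤ
    lemma₁ = solve-∀
    lemma₂ : ∀ a s → a ℤ.+ 1ℤ ℤ.- (1ℤ ℤ.- s) ≡ a ℤ.+ s
    lemma₂ = solve-∀

  -- The action descends to the quotient algebra. Right distributivity and centrality of scalars
  -- come from linearity in φ; the defining relation is `act-commutation`.
  act-resp-∼ : ∀ {X Y} → X ∼ Y → ∀ φ a → act X φ a ≈ act Y φ a
  act-resp-∼ ∼-refl                 φ a = refl
  act-resp-∼ (∼-sym p)              φ a = sym (act-resp-∼ p φ a)
  act-resp-∼ (∼-trans p p′)         φ a = trans (act-resp-∼ p φ a) (act-resp-∼ p′ φ a)
  act-resp-∼ (⊕-cong p p′)          φ a = +-cong (act-resp-∼ p φ a) (act-resp-∼ p′ φ a)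
  act-resp-∼ (⊗-cong {b = Y} p p′)  φ a = trans (act-cong Y (act-resp-∼ p φ) a) (act-resp-∼ p′ _ a)
  act-resp-∼ (⊖-cong p)             φ a = -‿cong (act-resp-∼ p φ a)
  act-resp-∼ (⊕-assoc _ _ _)        φ a = +-assoc _ _ _
  act-resp-∼ (⊕-comm _ _)           φ a = +-comm _ _
  act-resp-∼ (⊕-identityˡ _)        φ a = trans (+-congʳ (zeroˡ _)) (+-identityˡ _)
  act-resp-∼ (⊖-inverseˡ _)         φ a = trans (-‿inverseˡ _) (sym (zeroˡ _))
  act-resp-∼ (⊗-assoc _ _ _)        φ a = refl
  act-resp-∼ (⊗-identityˡ X)        φ a = act-cong X (λ b → *-identityˡ (φ b)) a
  act-resp-∼ (⊗-identityʳ _)        φ a = *-identityˡ _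
  act-resp-∼ (⊗-distribˡ-⊕ _ _ _)   φ a = refl
  act-resp-∼ (⊗-distribʳ-⊕ X _ _)   φ a = act-+ X _ _ a
  act-resp-∼ (scalar-cong x≈y)      φ a = *-congʳ x≈y
  act-resp-∼ (scalar-+ _ _)         φ a = distribʳ _ _ _
  act-resp-∼ (scalar-* x y)         φ a =
    solve 3 (λ x y z → x :* y :* z := y :* (x :* z)) refl x y (φ a)
  act-resp-∼ (scalar-comm x X)      φ a = act-* X x φ a
  act-resp-∼ commutation            φ a = act-commutation φ a

  act-sum : ∀ {n} (X : Fin n → Expr) φ a → act (Alg.sum X) φ a ≈ sum (λ i → act (X i) φ a)
  act-sum {zero}  X φ a = zeroˡ _
  act-sum {suc n} X φ a = +-congˡ (act-sum (λ i → X (fsuc i)) φ a)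

  -- Comparing scalars in the normal ordering expansion.

  -- A monomial sends each basis vector to a multiple of one basis vector. This functional extracts
  -- the multiple and forgets the vector, so powers of `V` on the left leave no trace.
  𝟙 : ℤ → Carrier
  𝟙 _ = 1#

  -- The scalar that `H` collects from eₐ, without its powers of `h`. The rightmost block acts
  -- first: its U's lower the index by t d, then its V's raise it by r.
  fallings : ∀ {n} → Vec ℕ n → Vec ℕ n → ℤ → Carrier
  fallings []      []      a = 1#
  fallings (r ∷ 𝐫) (t ∷ 𝐬) a = falling a t * fallings 𝐫 𝐬 (a ℤ.- + t ℤ.* d ℤ.+ + r)

  act-H : ∀ {n} (𝐫 𝐬 : Vec ℕ n) a → act (H 𝐫 𝐬) 𝟙 a ≈ h ^ Vec.sum 𝐬 * fallings 𝐫 𝐬 a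
  act-H []      []      a = refl
  act-H (r ∷ 𝐫) (t ∷ 𝐬) a = begin
    act (U Alg.^ t) (act (V Alg.^ r) (act (H 𝐫 𝐬) 𝟙)) a     ≈⟨ act-U^ t _ a ⟩
    h ^ t * falling a t * act (V Alg.^ r) (act (H 𝐫 𝐬) 𝟙) (a ℤ.- + t ℤ.* d)
      ≈⟨ *-congˡ (trans (act-V^ r _ _) (act-H 𝐫 𝐬 _)) ⟩
    h ^ t * falling a t * (h ^ Vec.sum 𝐬 * fallings 𝐫 𝐬 (a ℤ.- + t ℤ.* d ℤ.+ + r))
      ≈⟨ solve 4 (λ x y z w → x :* y :* (z :* w) := x :* z :* (y :* w)) refl _ _ _ _ ⟩
    h ^ t * h ^ Vec.sum 𝐬 * fallings (r ∷ 𝐫) (t ∷ 𝐬) a      ≈⟨ *-congʳ (^-homo-* h t (Vec.sum 𝐬)) ⟨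
    h ^ (t ℕ.+ Vec.sum 𝐬) * fallings (r ∷ 𝐫) (t ∷ 𝐬) a      ∎

  -- Unrolling the recursion, block t starts at the index `a` shifted by all earlier blocks, which
  -- the prefix sums record.
  fallings-product : ∀ {n} (𝐫 𝐬 : Vec ℕ n) a →
    (product λ t → falling (a ℤ.- + prefixSum 𝐬 t ℤ.* d ℤ.+ + prefixSum 𝐫 t) (lookup 𝐬 t))
      ≈ fallings 𝐫 𝐬 a
  fallings-product []      []      a = refl
  fallings-product {suc n} (r ∷ 𝐫) (t ∷ 𝐬) a = *-cong
    (reflexive (cong (λ b → falling b t) (≡.trans (ℤP.+-identityʳ _) (ℤP.+-identityʳ a))))
    (trans (product-cong {n} λ i → reflexive (cong (λ b → falling b (lookup 𝐬 i)) (shift (prefixSum 𝐬 i) (prefixSum 𝐫 i))))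
      (fallings-product 𝐫 𝐬 _))
    where
    lemma : ∀ a t r x y d → a ℤ.- (t ℤ.+ x) ℤ.* d ℤ.+ (r ℤ.+ y) ≡ (a ℤ.- t ℤ.* d ℤ.+ r) ℤ.- x ℤ.* d ℤ.+ y
    lemma = solve-∀
    shift : ∀ x y → a ℤ.- + (t ℕ.+ x) ℤ.* d ℤ.+ + (r ℕ.+ y)
                  ≡ (a ℤ.- + t ℤ.* d ℤ.+ + r) ℤ.- + x ℤ.* d ℤ.+ + y
    shift x y = lemma a (+ t) (+ r) (+ x) (+ y) d

  -- Multiplied by 1 - s, the rational base of each factor becomes the integer index at which that
  -- block starts when a = j (1 - s).
  Ω-fallings : ∀ {n} (𝐫 𝐬 : Vec ℕ n) j → Ω 𝐫 𝐬 j ≈ fallings 𝐫 𝐬 (+ j ℤ.* d)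
  Ω-fallings {n} 𝐫 𝐬 j = trans
    (product-cong {n} λ t → let x = + prefixSum 𝐬 t ; y = + prefixSum 𝐫 t in
      fallingFactorial-falling
        (fromℤ (+ j) ℚ.- fromℤ x ℚ.+ ℚ._÷_ (fromℤ y) (fromℤ d) {{1-s-nonZero s≢1}})
        (lookup 𝐬 t) ([j-x+y/d]*d (+ j) x y d {{1-s-nonZero s≢1}}))
    (fallings-product 𝐫 𝐬 (+ j ℤ.* d))

  -- For a negative exponent the monomial is read as 0, so the uniform formula holds only because
  -- the coefficient vanishes as well.
  act-monomialVU : ∀ x e k a → (e ℤ.< 0ℤ → x ≈ 0#) →
    act (monomialVU x e k) 𝟙 a ≈ x * (h ^ k * falling a k)
  act-monomialVU x (+ e) k a _ = begin
    act (U Alg.^ k) (act (V Alg.^ e) (λ _ → x * 1#)) a  ≈⟨ act-U^ k _ a ⟩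
    h ^ k * falling a k * act (V Alg.^ e) (λ _ → x * 1#) (a ℤ.- + k ℤ.* d)
      ≈⟨ *-congˡ (act-V^ e _ _) ⟩
    h ^ k * falling a k * (x * 1#)                      ≈⟨ *-congˡ (*-identityʳ x) ⟩
    h ^ k * falling a k * x                             ≈⟨ *-comm _ _ ⟩
    x * (h ^ k * falling a k)                           ∎
  act-monomialVU x -[1+ e ] k a x≈0 = begin
    0# * 1#                    ≈⟨ zeroˡ _ ⟩
    0#                         ≈⟨ zeroˡ _ ⟨
    0# * (h ^ k * falling a k) ≈⟨ *-congʳ (x≈0 ℤ.-<+) ⟨
    x * (h ^ k * falling a k)  ∎

  range≤ : ∀ a b (i : Fin (suc b ∸ a)) → range a b i ℕ.≤ b
  range≤ zero    b       i = ℕ.s≤s⁻¹ (toℕ<n i)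
  range≤ (suc a) (suc b) i = ℕ.s≤s (range≤ a b i)
  -- The index type is `Fin (zero ∸ a)` here, which is seen to be empty only after a further split
  -- on `a`.
  range≤ (suc zero) zero ()
  range≤ (suc (suc a)) zero ()

  Ω-expansion : ∀ {n} (𝐫 𝐬 : Vec ℕ (suc n)) S → IsNormalOrdering 𝐫 𝐬 S → ∀ j →
    h ^ Vec.sum 𝐬 * Ω 𝐫 𝐬 j ≈ sum λ i → let k = range (head 𝐬) (Vec.sum 𝐬) i in
      S k * (h ^ k * falling (+ j ℤ.* d) k)
  Ω-expansion 𝐫 𝐬 S no j = begin
    h ^ Vec.sum 𝐬 * Ω 𝐫 𝐬 j                     ≈⟨ *-congˡ (Ω-fallings 𝐫 𝐬 j) ⟩
    h ^ Vec.sum 𝐬 * fallings 𝐫 𝐬 (+ j ℤ.* d)    ≈⟨ act-H 𝐫 𝐬 _ ⟨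
    act (H 𝐫 𝐬) 𝟙 (+ j ℤ.* d)                   ≈⟨ act-resp-∼ expansion 𝟙 _ ⟩
    act (Alg.sum monomials) 𝟙 (+ j ℤ.* d)       ≈⟨ act-sum monomials 𝟙 _ ⟩
    sum (λ i → act (monomials i) 𝟙 (+ j ℤ.* d)) ≈⟨ sum-cong-≋ (λ i → let k = κ i in
      act-monomialVU (S k) (exponentV 𝐫 𝐬 k) k (+ j ℤ.* d)
        (vanishing k (ℕP.m≤m+n _ _) (range≤ (head 𝐬) (Vec.sum 𝐬) i))) ⟩
    sum (λ i → S (κ i) * (h ^ κ i * falling (+ j ℤ.* d) (κ i))) ∎
    where
    open IsNormalOrdering no
    κ = range (head 𝐬) (Vec.sum 𝐬)
    monomials = λ i → monomialVU (S (κ i)) (exponentV 𝐫 𝐬 (κ i)) (κ i)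

  -- Power series and the q-exponential.

  -- The eigenvalue at xʲ of the operator D : xʲ ↦ h [j(1-s)] xʲ, and for j > 0 the ratio of h^j
  -- [j]! to its predecessor.
  qStep : ℕ → Carrier
  qStep j = h * qNumber (+ j ℤ.* d)

  qStep-0 : qStep 0 ≈ 0#
  qStep-0 = trans (*-congˡ qNumber-0) (zeroʳ h)

  qStep-suc#0 : ∀ j → qStep (suc j) # 0#
  qStep-suc#0 j = x#0y#0→xy#0 h#0 (qNumber-suc#0 j)

  qStep-+ : ∀ l j → qStep (l ℕ.+ j) ≈ qStep l + qPower l * qStep j
  qStep-+ l j = begin
    h * qNumber (+ (l ℕ.+ j) ℤ.* d)                    ≡⟨ cong (λ x → h * qNumber x) (ℤP.*-distribʳ-+ d (+ l) (+ j)) ⟩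
    h * qNumber (+ l ℤ.* d ℤ.+ + j ℤ.* d)              ≈⟨ *-congˡ (qNumber-+ _ _) ⟩
    h * (qNumber (+ l ℤ.* d) + qPower l * qNumber (+ j ℤ.* d))  ≈⟨ solve 4
      (λ h x p y → h :* (x :+ p :* y) := h :* x :+ p :* (h :* y)) refl _ _ _ _ ⟩
    qStep l + qPower l * qStep j                       ∎

  ⋆-cong : ∀ {f f′ g g′} → f ≋ f′ → g ≋ g′ → f ⋆ g ≋ f′ ⋆ g′
  ⋆-cong f≋f′ g≋g′ m = sum-cong-≋ {suc m} λ i → *-cong (f≋f′ (toℕ i)) (g≋g′ (m ∸ toℕ i))

  -- `sum` unfolds at its first term; this splits off the last one, so that the shift falls on `g`
  -- instead of `f`.
  ⋆-suc : ∀ f g m → (f ⋆ g) (suc m) ≈ (f ⋆ (λ j → g (suc j))) m + f (suc m) * g 0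
  ⋆-suc f g zero    = solve 2 (λ x y → x :+ (y :+ con 0) := x :+ con 0 :+ y) refl _ _
  ⋆-suc f g (suc m) = trans (+-congˡ (⋆-suc (λ l → f (suc l)) g m)) (sym (+-assoc _ _ _))

  ⋆-sum : ∀ {n} f (a : Fin n → Carrier) (g : Fin n → PowerSeries) m →
    (f ⋆ λ j → sum λ i → a i * g i j) m ≈ sum λ i → a i * (f ⋆ g i) m
  ⋆-sum {n} f a g m = begin
    (sum λ l → F l * sum λ i → a i * G i l)         ≈⟨ (sum-cong-≋ {suc m} λ l → *-distribˡ-sum (F l) (λ i → a i * G i l)) ⟩
    (sum λ l → sum λ i → F l * (a i * G i l))       ≈⟨ ∑-comm {suc m} {n} (λ l i → F l * (a i * G i l)) ⟩
    (sum λ i → sum λ l → F l * (a i * G i l))       ≈⟨ (sum-cong-≋ {n} λ i → sum-cong-≋ {suc m} λ l →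
      solve 3 (λ x y z → x :* (y :* z) := y :* (x :* z)) refl (F l) (a i) (G i l)) ⟩
    (sum λ i → sum λ l → a i * (F l * G i l))       ≈⟨ (sum-cong-≋ {n} λ i → *-distribˡ-sum (a i) (λ l → F l * G i l)) ⟨
    (sum λ i → a i * sum λ l → F l * G i l)         ∎
    where
    F : Fin (suc m) → Carrier
    F l = f (toℕ l)
    G : Fin n → Fin (suc m) → Carrier
    G i l = g i (m ∸ toℕ l)

  ⋆-neg : ∀ f g m → ((λ l → - f l) ⋆ g) m + (f ⋆ g) m ≈ 0#
  ⋆-neg f g m = begin
    ((λ l → - f l) ⋆ g) m + (f ⋆ g) m                                                
      ≈⟨ ∑-distrib-+ {suc m} (λ i → - f (toℕ i) * g (m ∸ toℕ i)) (λ i → f (toℕ i) * g (m ∸ toℕ i)) ⟨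
    (sum λ (i : Fin (suc m)) → - f (toℕ i) * g (m ∸ toℕ i) + f (toℕ i) * g (m ∸ toℕ i))  ≈⟨ (sum-cong-≋ {suc m} λ i →
      trans (sym (distribʳ (g (m ∸ toℕ i)) (- f (toℕ i)) (f (toℕ i)))) (trans (*-congʳ (-‿inverseˡ (f (toℕ i)))) (zeroˡ _))) ⟩
    (sum λ (i : Fin (suc m)) → 0#)                                                   ≈⟨ sum-replicate-zero (suc m) ⟩
    0#                                                                               ∎

  -- The q-Leibniz rule for the derivation-like operator xʲ ↦ h [j(1-s)] xʲ.
  ⋆-leibniz : ∀ f g m → qStep m * (f ⋆ g) m
    ≈ ((λ l → qStep l * f l) ⋆ g) m + ((λ l → qPower l * f l) ⋆ (λ j → qStep j * g j)) m
  ⋆-leibniz f g m = begin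
    qStep m * (f ⋆ g) m                                             ≈⟨ *-distribˡ-sum (qStep m) (λ (i : Fin (suc m)) → f (toℕ i) * g (m ∸ toℕ i)) ⟩
    (sum λ (i : Fin (suc m)) → qStep m * (f (toℕ i) * g (m ∸ toℕ i))) ≈⟨ (sum-cong-≋ {suc m} λ i → term (toℕ i) (ℕ.s≤s⁻¹ (toℕ<n i))) ⟩
    (sum λ (i : Fin (suc m)) → qStep (toℕ i) * f (toℕ i) * g (m ∸ toℕ i)
      + qPower (toℕ i) * f (toℕ i) * (qStep (m ∸ toℕ i) * g (m ∸ toℕ i)))  ≈⟨ ∑-distrib-+ {suc m}
        (λ i → qStep (toℕ i) * f (toℕ i) * g (m ∸ toℕ i))
        (λ i → qPower (toℕ i) * f (toℕ i) * (qStep (m ∸ toℕ i) * g (m ∸ toℕ i))) ⟩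
    ((λ l → qStep l * f l) ⋆ g) m + ((λ l → qPower l * f l) ⋆ (λ j → qStep j * g j)) m ∎
    where
    term : ∀ l → l ℕ.≤ m → qStep m * (f l * g (m ∸ l))
      ≈ qStep l * f l * g (m ∸ l) + qPower l * f l * (qStep (m ∸ l) * g (m ∸ l))
    term l l≤m = begin
      qStep m * (f l * g (m ∸ l))                   ≡⟨ cong (λ k → qStep k * (f l * g (m ∸ l))) (ℕP.m+[n∸m]≡n l≤m) ⟨
      qStep (l ℕ.+ (m ∸ l)) * (f l * g (m ∸ l))     ≈⟨ *-congʳ (qStep-+ l (m ∸ l)) ⟩
      (qStep l + qPower l * qStep (m ∸ l)) * (f l * g (m ∸ l))  ≈⟨ solve 5
        (λ x p y f g → (x :+ p :* y) :* (f :* g) := x :* f :* g :+ p :* f :* (y :* g)) refl _ _ _ _ _ ⟩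
      qStep l * f l * g (m ∸ l) + qPower l * f l * (qStep (m ∸ l) * g (m ∸ l))  ∎

  h^*qFactorial : ℕ → Carrier
  h^*qFactorial j = h ^ j * qFactorial j

  h^*qFactorial#0 : ∀ j → h^*qFactorial j # 0#
  h^*qFactorial#0 j = x#0y#0→xy#0 (^-#0 h#0 j) (qFactorial#0 j)

  h^*qFactorial-suc : ∀ j → h^*qFactorial (suc j) ≈ qStep (suc j) * h^*qFactorial j
  h^*qFactorial-suc j = trans (*-congˡ (qFactorial-suc j))
    (solve 4 (λ h x n f → h :* x :* (n :* f) := h :* n :* (x :* f)) refl _ _ _ _)

  qExp : PowerSeries
  qExp j = inverse (h^*qFactorial#0 j)

  qExp-0 : qExp 0 ≈ 1#
  qExp-0 = begin
    qExp 0             ≈⟨ *-identityʳ _ ⟨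
    qExp 0 * 1#        ≈⟨ *-congˡ (*-identityʳ 1#) ⟨
    qExp 0 * (1# * 1#) ≈⟨ inverseˡ (h^*qFactorial#0 0) ⟩
    1#                 ∎

  -- In terms of D this says D `qExp` = x `qExp`.
  qExp-suc : ∀ j → qStep (suc j) * qExp (suc j) ≈ qExp j
  qExp-suc j = *-cancelˡ-#0 _ _ (h^*qFactorial#0 j) (begin
    h^*qFactorial j * (qStep (suc j) * qExp (suc j))    ≈⟨ solve 3 (λ x y z → x :* (y :* z) := z :* (y :* x)) refl _ _ _ ⟩
    qExp (suc j) * (qStep (suc j) * h^*qFactorial j)    ≈⟨ *-congˡ (h^*qFactorial-suc j) ⟨
    qExp (suc j) * h^*qFactorial (suc j)                ≈⟨ inverseˡ (h^*qFactorial#0 (suc j)) ⟩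
    1#                                                  ≈⟨ inverseˡ (h^*qFactorial#0 j) ⟨
    qExp j * h^*qFactorial j                            ≈⟨ *-comm _ _ ⟩
    h^*qFactorial j * qExp j                            ∎)

  -- The series xᵏ qExp.
  shiftedExp : ℕ → PowerSeries
  shiftedExp k j = h ^ k * falling (+ j ℤ.* d) k * qExp j

  shiftedExp-zero : shiftedExp 0 ≋ qExp
  shiftedExp-zero j = trans (*-congʳ (*-identityˡ 1#)) (*-identityˡ _)

  shiftedExp-suc-0 : ∀ k → shiftedExp (suc k) 0 ≈ 0#
  shiftedExp-suc-0 k = begin
    h ^ suc k * (qNumber 0ℤ * x) * qExp 0   ≈⟨ *-congʳ (*-congˡ (*-congʳ qNumber-0)) ⟩
    h ^ suc k * (0# * x) * qExp 0           ≈⟨ solve 3 (λ y x z → y :* (con 0 :* x) :* z := con 0) refl (h ^ suc k) x _ ⟩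
    0#                                      ∎
    where
    x = falling (0ℤ ℤ.- d) k

  -- The leading factor h [(j+1)(1-s)] of the falling factorial turns `qExp (suc j)` into `qExp j`.
  -- With the zero constant term, passing from k to k + 1 is thus multiplication by x.
  shiftedExp-suc : ∀ k j → shiftedExp (suc k) (suc j) ≈ shiftedExp k j
  shiftedExp-suc k j = begin
    h ^ suc k * (qNumber (+ suc j ℤ.* d) * falling (+ suc j ℤ.* d ℤ.- d) k) * qExp (suc j)
      ≡⟨ cong (λ a → h ^ suc k * (qNumber (+ suc j ℤ.* d) * falling a k) * qExp (suc j)) (suc-*-d∸d j) ⟩
    h ^ suc k * (qNumber (+ suc j ℤ.* d) * falling (+ j ℤ.* d) k) * qExp (suc j)
      ≈⟨ solve 5 (λ h x n f e → h :* x :* (n :* f) :* e := x :* f :* (h :* n :* e)) refl _ _ _ _ _ ⟩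
    h ^ k * falling (+ j ℤ.* d) k * (qStep (suc j) * qExp (suc j))
      ≈⟨ *-congˡ (qExp-suc j) ⟩
    h ^ k * falling (+ j ℤ.* d) k * qExp j ∎

  -- The hypothesis is D f(x) = -x f(q^(1-s) x), a recurrence that fixes f up to its constant term.
  module _ (f : PowerSeries) (f-suc : ∀ j → qStep (suc j) * f (suc j) ≈ - (qPower j * f j)) where

    -- By the Leibniz rule D(f E) = -x f(q^(1-s) x) E + f(q^(1-s) x) x E = 0 with E = `qExp`. The
    -- eigenvalues of D in positive degree are invertible, so f E is constant.
    ⋆-qExp-suc : ∀ m → (f ⋆ qExp) (suc m) ≈ 0#
    ⋆-qExp-suc m = *-cancelˡ-#0 _ _ (qStep-suc#0 m) (begin
      qStep (suc m) * (f ⋆ qExp) (suc m)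
        ≈⟨ ⋆-leibniz f qExp (suc m) ⟩
      -- The first product loses its first term by unfolding and the second its last term by
      -- `⋆-suc`. Both lost terms contain `qStep 0`, which is zero.
      qStep 0 * f 0 * qExp (suc m) + ((λ l → qStep (suc l) * f (suc l)) ⋆ qExp) m
        + (pf ⋆ (λ j → qStep j * qExp j)) (suc m)
        ≈⟨ +-cong (+-cong (*-congʳ (*-congʳ qStep-0)) (⋆-cong {g = qExp} f-suc (λ _ → refl) m))
                  (⋆-suc pf (λ j → qStep j * qExp j) m) ⟩
      0# * f 0 * qExp (suc m) + ((λ l → - pf l) ⋆ qExp) m
        + ((pf ⋆ (λ j → qStep (suc j) * qExp (suc j))) m + pf (suc m) * (qStep 0 * qExp 0))
        ≈⟨ +-congˡ (+-cong (⋆-cong {f = pf} (λ _ → refl) qExp-suc m) (*-congˡ (*-congʳ qStep-0))) ⟩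
      0# * f 0 * qExp (suc m) + ((λ l → - pf l) ⋆ qExp) m
        + ((pf ⋆ qExp) m + pf (suc m) * (0# * qExp 0))
        ≈⟨ solve 6 (λ x y z w u v → con 0 :* x :* y :+ z :+ (w :+ u :* (con 0 :* v)) := z :+ w) refl _ _ _ _ _ _ ⟩
      ((λ l → - pf l) ⋆ qExp) m + (pf ⋆ qExp) m
        ≈⟨ ⋆-neg pf qExp m ⟩
      0#
        ≈⟨ zeroʳ _ ⟨
      qStep (suc m) * 0# ∎)
      where
      pf : PowerSeries
      pf l = qPower l * f l

    -- f E is the constant `f 0`, hence f xᵏ E = `f 0` xᵏ; the induction lowers k and the degree
    -- together.
    ⋆-shiftedExp : ∀ k → f ⋆ shiftedExp k ≋ monomial (f 0) k
    ⋆-shiftedExp zero zero =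
      trans (+-identityʳ _) (trans (*-congˡ (trans (shiftedExp-zero 0) qExp-0)) (*-identityʳ _))
    ⋆-shiftedExp zero (suc m) = trans (⋆-cong {f = f} (λ _ → refl) shiftedExp-zero (suc m)) (⋆-qExp-suc m)
    ⋆-shiftedExp (suc k) zero = trans (+-identityʳ _) (trans (*-congˡ (shiftedExp-suc-0 k)) (zeroʳ _))
    ⋆-shiftedExp (suc k) (suc m) = begin
      (f ⋆ shiftedExp (suc k)) (suc m)
        ≈⟨ ⋆-suc f (shiftedExp (suc k)) m ⟩
      (f ⋆ (λ j → shiftedExp (suc k) (suc j))) m + f (suc m) * shiftedExp (suc k) 0
        ≈⟨ +-cong (⋆-cong {f = f} (λ _ → refl) (shiftedExp-suc k) m) (*-congˡ (shiftedExp-suc-0 k)) ⟩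
      (f ⋆ shiftedExp k) m + f (suc m) * 0#
        ≈⟨ trans (+-congˡ (zeroʳ _)) (+-identityʳ _) ⟩
      (f ⋆ shiftedExp k) m
        ≈⟨ ⋆-shiftedExp k m ⟩
      monomial (f 0) k m ∎

  -- The recurrence of the exponential factor.

  exponentialNumerator : ℕ → ℕ → Carrier
  exponentialNumerator N j =
    power h h#0 (+ N ℤ.- + j) * (- 1#) ^ j * power q q#0 (+ (j C 2) ℤ.* d)

  -- Pascal's rule gives C(j+1, 2) = j + C(j, 2), which produces `qPower j`; the extra h restores
  -- the exponent N - j, and the sign alternates.
  exponentialNumerator-suc : ∀ N j →
    h * exponentialNumerator N (suc j) ≈ - (qPower j * exponentialNumerator N j)
  exponentialNumerator-suc N j = begin
    h * (hⁿ (+ N ℤ.- + suc j) * (- 1# * (- 1#) ^ j) * qⁿ (+ (suc j C 2) ℤ.* d))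
      ≡⟨ cong (λ x → h * (hⁿ (+ N ℤ.- + suc j) * (- 1# * (- 1#) ^ j) * qⁿ x)) C2 ⟩
    h * (hⁿ (+ N ℤ.- + suc j) * (- 1# * (- 1#) ^ j) * qⁿ (+ j ℤ.* d ℤ.+ + (j C 2) ℤ.* d))
      ≈⟨ *-congˡ (*-congˡ (power-+ q#0 (+ j ℤ.* d) (+ (j C 2) ℤ.* d))) ⟩
    h * (hⁿ (+ N ℤ.- + suc j) * (- 1# * (- 1#) ^ j) * (qPower j * qⁿ (+ (j C 2) ℤ.* d)))
      ≈⟨ solve 6 (λ h x u v p c → h :* (x :* (u :* v) :* (p :* c)) := u :* (p :* (h :* x :* v :* c))) refl _ _ _ _ _ _ ⟩
    - 1# * (qPower j * (h * hⁿ (+ N ℤ.- + suc j) * (- 1#) ^ j * qⁿ (+ (j C 2) ℤ.* d)))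
      ≈⟨ *-congˡ (*-congˡ (*-congʳ (*-congʳ h-step))) ⟩
    - 1# * (qPower j * exponentialNumerator N j)
      ≈⟨ -1*x≈-x _ ⟩
    - (qPower j * exponentialNumerator N j) ∎
    where
    hⁿ = power h h#0
    qⁿ = power q q#0
    C2 : + (suc j C 2) ℤ.* d ≡ + j ℤ.* d ℤ.+ + (j C 2) ℤ.* d
    C2 = ≡.trans
      (cong (λ x → + x ℤ.* d)
        (≡.trans (≡.sym (nCk+nC[k+1]≡[n+1]C[k+1] j 1)) (cong (ℕ._+ j C 2) (nC1≡n j))))
      (ℤP.*-distribʳ-+ d (+ j) (+ (j C 2)))
    lemma : ∀ x y → 1ℤ ℤ.+ (x ℤ.- (1ℤ ℤ.+ y)) ≡ x ℤ.- y
    lemma = solve-∀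
    h-step : h * hⁿ (+ N ℤ.- + suc j) ≈ hⁿ (+ N ℤ.- + j)
    h-step = begin
      h * hⁿ (+ N ℤ.- + suc j)          ≈⟨ *-congʳ (*-identityʳ h) ⟨
      hⁿ 1ℤ * hⁿ (+ N ℤ.- + suc j)      ≈⟨ power-+ h#0 1ℤ (+ N ℤ.- + suc j) ⟨
      hⁿ (1ℤ ℤ.+ (+ N ℤ.- + suc j))     ≡⟨ cong hⁿ (lemma (+ N) (+ j)) ⟩
      hⁿ (+ N ℤ.- + j)                  ∎

  module _ {n} (𝐬 : Vec ℕ n) where

    exponentialFactor-* : ∀ j → exponentialFactor 𝐬 j * qFactorial j ≈ exponentialNumerator (Vec.sum 𝐬) j
    exponentialFactor-* j = divide-* _ (qFactorial#0 j)

    exponentialFactor-0 : exponentialFactor 𝐬 0 ≈ h ^ Vec.sum 𝐬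
    exponentialFactor-0 = begin
      exponentialFactor 𝐬 0                      ≈⟨ *-identityʳ _ ⟨
      exponentialFactor 𝐬 0 * 1#                 ≈⟨ exponentialFactor-* 0 ⟩
      -- At j = 0 the sign, the power of q and `qFactorial 0` all compute to `1#`, while the integer
      -- N - 0 computes to N + 0.
      h ^ (Vec.sum 𝐬 ℕ.+ 0) * 1# * 1#            ≈⟨ trans (*-identityʳ _) (*-identityʳ _) ⟩
      h ^ (Vec.sum 𝐬 ℕ.+ 0)                      ≡⟨ cong (h ^_) (ℕP.+-identityʳ (Vec.sum 𝐬)) ⟩
      h ^ Vec.sum 𝐬                              ∎

    -- Multiplying by [j]! completes [(j+1)(1-s)] to [j+1]!, which reduces the claim to the
    -- recurrence of the numerators.
    exponentialFactor-suc : ∀ j →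
      qStep (suc j) * exponentialFactor 𝐬 (suc j) ≈ - (qPower j * exponentialFactor 𝐬 j)
    exponentialFactor-suc j = *-cancelˡ-#0 _ _ (qFactorial#0 j) (begin
      qFactorial j * (h * qNumber (+ suc j ℤ.* d) * f (suc j))
        ≈⟨ solve 4 (λ x h n f → x :* (h :* n :* f) := h :* (f :* (n :* x))) refl _ _ _ _ ⟩
      h * (f (suc j) * (qNumber (+ suc j ℤ.* d) * qFactorial j))
        ≈⟨ *-congˡ (*-congˡ (qFactorial-suc j)) ⟨
      h * (f (suc j) * qFactorial (suc j))
        ≈⟨ *-congˡ (exponentialFactor-* (suc j)) ⟩
      h * exponentialNumerator (Vec.sum 𝐬) (suc j)
        ≈⟨ exponentialNumerator-suc (Vec.sum 𝐬) j ⟩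
      - (qPower j * exponentialNumerator (Vec.sum 𝐬) j)
        ≈⟨ -‿cong (*-congˡ (exponentialFactor-* j)) ⟨
      - (qPower j * (f j * qFactorial j))
        ≈⟨ -‿cong (solve 3 (λ p f x → p :* (f :* x) := x :* (p :* f)) refl _ _ _) ⟩
      - (qFactorial j * (qPower j * f j))
        ≈⟨ -‿distribʳ-* _ _ ⟩
      qFactorial j * - (qPower j * f j) ∎)
      where
      f = exponentialFactor 𝐬

  -- The factorisation of the Bell polynomial.

  *-monomial : ∀ x y k m → x * monomial y k m ≈ y * monomial x k m
  *-monomial x y k m with does (k ℕP.≟ m)
  ... | true  = *-comm x y
  ... | false = trans (zeroʳ x) (sym (zeroʳ y))

  -- Both sides are multiplied by h^|𝐬|, the form in which `Ω-expansion` applies. The same power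
  -- reappears as the constant term of the exponential factor and is then cancelled.
  bellPolynomial-factorisation : ∀ {n} (𝐫 𝐬 : Vec ℕ (suc n)) (S : ℕ → Carrier) →
    IsNormalOrdering 𝐫 𝐬 S → bellPolynomial 𝐬 S ≋ exponentialFactor 𝐬 ⋆ ΩSeries 𝐫 𝐬
  bellPolynomial-factorisation 𝐫 𝐬 S no m = sym (*-cancelˡ-#0 _ _ (^-#0 h#0 (Vec.sum 𝐬)) (begin
    hᴺ * (f ⋆ ΩSeries 𝐫 𝐬) m
      ≈⟨ *-distribˡ-sum hᴺ (λ (l : Fin (suc m)) → f (toℕ l) * ΩSeries 𝐫 𝐬 (m ∸ toℕ l)) ⟩
    (sum λ (l : Fin (suc m)) → hᴺ * (f (toℕ l) * ΩSeries 𝐫 𝐬 (m ∸ toℕ l)))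
      ≈⟨ (sum-cong-≋ {suc m} λ l → solve 3 (λ x y z → x :* (y :* z) := y :* (x :* z)) refl hᴺ (f (toℕ l)) (ΩSeries 𝐫 𝐬 (m ∸ toℕ l))) ⟩
    (f ⋆ λ j → hᴺ * ΩSeries 𝐫 𝐬 j) m
      ≈⟨ ⋆-cong {f = f} (λ _ → refl) ΩSeries-expansion m ⟩
    (f ⋆ λ j → sum λ i → S (κ i) * shiftedExp (κ i) j) m
      ≈⟨ ⋆-sum f (λ i → S (κ i)) (λ i → shiftedExp (κ i)) m ⟩
    (sum λ i → S (κ i) * (f ⋆ shiftedExp (κ i)) m)
      ≈⟨ (sum-cong-≋ λ i → *-congˡ (⋆-shiftedExp f (exponentialFactor-suc 𝐬) (κ i) m)) ⟩
    (sum λ i → S (κ i) * monomial (f 0) (κ i) m)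
      ≈⟨ (sum-cong-≋ λ i → trans (*-monomial (S (κ i)) (f 0) (κ i) m) (*-congʳ (exponentialFactor-0 𝐬))) ⟩
    (sum λ i → hᴺ * monomial (S (κ i)) (κ i) m)
      ≈⟨ *-distribˡ-sum hᴺ (λ i → monomial (S (κ i)) (κ i) m) ⟨
    hᴺ * bellPolynomial 𝐬 S m ∎))
    where
    f = exponentialFactor 𝐬
    hᴺ = h ^ Vec.sum 𝐬
    κ = range (head 𝐬) (Vec.sum 𝐬)
    ΩSeries-expansion : ∀ j → hᴺ * ΩSeries 𝐫 𝐬 j ≈ sum λ i → S (κ i) * shiftedExp (κ i) j
    ΩSeries-expansion j = begin
      -- `ΩSeries` divides by h^j [j]! with the same apartness proof as `qExp`, so it unfolds to
      -- this product.
      hᴺ * (Ω 𝐫 𝐬 j * qExp j)   ≈⟨ *-assoc _ _ _ ⟨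
      hᴺ * Ω 𝐫 𝐬 j * qExp j     ≈⟨ *-congʳ (Ω-expansion 𝐫 𝐬 S no j) ⟩
      (sum λ i → S (κ i) * (h ^ κ i * falling (+ j ℤ.* d) (κ i))) * qExp j
        ≈⟨ *-distribʳ-sum (qExp j) (λ i → S (κ i) * (h ^ κ i * falling (+ j ℤ.* d) (κ i))) ⟩
      (sum λ i → S (κ i) * (h ^ κ i * falling (+ j ℤ.* d) (κ i)) * qExp j)
        ≈⟨ (sum-cong-≋ λ i → *-assoc (S (κ i)) (h ^ κ i * falling (+ j ℤ.* d) (κ i)) (qExp j)) ⟩
      (sum λ i → S (κ i) * shiftedExp (κ i) j) ∎

corollary14 :
  ∀ {c ℓ₁ ℓ₂} (K : HeytingField c ℓ₁ ℓ₂) →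
  let open HeytingField K
      open FieldNotions K in
  (char0 : CharacteristicZero)
  (s : ℕ) (s≢1 : s ≢ 1)
  (h : Carrier) (h#0 : h # 0#)
  (q : Carrier) (q#0 : q # 0#)
  (q-generic : q ≈ 1# ⊎ NotRootOfUnity q) →
  let open NormalOrdering K char0 s s≢1 h h#0 q q#0 q-generic in
  ∀ {n} (𝐫 𝐬 : Vec ℕ (suc n)) (S : ℕ → Carrier) →
  IsNormalOrdering 𝐫 𝐬 S →
  bellPolynomial 𝐬 S ≋ exponentialFactor 𝐬 ⋆ ΩSeries 𝐫 𝐬
corollary14 K char0 s s≢1 h h#0 q q#0 q-generic =
  NormalOrderingProperties.bellPolynomial-factorisation K char0 s s≢1 h h#0 q q#0 q-generic
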